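{- Let $\beta\in \mathrm{Sym}_n(\mathbb Q)$ be positive semi-definite of rank $n-1$, $\ell_j$ a cusp, and $U_{ij}$ one of the finitely many $n$-dimensional subspaces of the form $\mathrm{span}(X)$, $X\in\Omega_{\beta,j}\cap(L^n+h)$. The action of $\Gamma_j$ on $\Omega_{\beta,j}$ induces a free action of $\Gamma_{U_{ij}}\backslash\Gamma_j$ on $\Omega_{\beta,i,j}$, where $\Gamma_{U_{ij}}=N_{U_{ij}}\cap\Gamma_j$ is the subgroup of $\Gamma_j$ acting trivially on $U_{ij}$.
   Context: $V$ is a $\mathbb Q$-vector space of dimension $p+1$ with a non-degenerate symmetric bilinear form $(\,,)$ of signature $(p,1)$; $L\subset V$ is a $\mathbb Z$-lattice of full rank with $L\subset L^{\#}$ (dual lattice); $1\le n\le p$, $h\in(L^{\#})^n$. $G_0(\mathbb R)$ is the identity component of $SO(V)(\mathbb R)$ and $\Gamma$ is a neat subgroup of finite index in the stabilizer of $L$ in $G_0(\mathbb R)$, acting trivially on $L^{\#}/L$; $V$ has nonzero rational isotropic vectors. $\ell_0,\dots,\ell_r$ represent the $\Gamma$-orbits of rational isotropic lines. $N_j$ is the unipotent radical of the parabolic subgroup stabilizing $\ell_j$; it fixes $\ell_j$ pointwise and acts trivially on $\ell_j^\perp/\ell_j$; $\Gamma_j=\Gamma\cap N_j$, and for $U\subset\ell_j^\perp$, $N_U=\{g\in N_j:g|_U=\mathrm{id}\}$. For $X\in V^n$, $(X,X)=((x_i,x_j))$, and $R(X)$ is the radical of $\mathrm{span}(X)$. $\Omega_{\beta,j}=\{X\in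 V^n:\frac12(X,X)=\beta,\ R(X)=\ell_j\}$ and $\Omega_{\beta,i,j}=\{X\in\Omega_{\beta,j}:\mathrm{span}(X)=U_{ij}\}$. -}

module Defs where

open import Algebra.Bundles using (Group; AbelianGroup; RawRing; Ring)
import Algebra.Construct.Pointwise as Pointwise
import Algebra.Definitions.RawMonoid as RawMonoidDefs
import Algebra.Definitions.RawSemiring as RawSemiringDefs
open import Algebra.Module.Bundles using (LeftModule)
open import Algebra.Module.Morphism.Structures using (module LeftModuleMorphisms)
import Algebra.Module.Morphism.Construct.Composition as Composition
import Algebra.Module.Morphism.Construct.Identity as Identity
import Algebra.Properties.Group as GroupProperties
open import Data.Fin.Base using (Fin; zero; suc; toℕ; punchIn)
open import Data.Fin.Properties using (_≟_)
open import Data.Integer.Base using (ℤ)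
open import Data.Nat.Base as ℕ using (ℕ; zero; suc)
import Data.Nat.Properties as ℕ
open import Data.Product.Base using (Σ; ∃; ∃-syntax; _×_; _,_; proj₁; proj₂)
open import Data.Rational.Base as ℚ using (ℚ; 0ℚ; 1ℚ; ½)
import Data.Rational.Properties as ℚ
open import Data.Rational.Solver using (module +-*-Solver)
open import Data.Vec.Functional using (Vector; _++_)
import Data.Vec.Functional.Relation.Binary.Equality.Setoid as VectorEquality
open import Function.Base using (_∘_; id)
open import Level using (Level; _⊔_; 0ℓ) renaming (suc to lsuc)
open import Relation.Binary.Bundles using (Setoid)
import Relation.Binary.Construct.On as On
open import Relation.Binary.PropositionalEquality using (_≡_; _≢_; refl; sym; trans; cong; subst; subst₂)
import Relation.Binary.Reasoning.Setoid as SetoidReasoning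
open import Relation.Nullary using (¬_; does)
open import Relation.Unary using (Pred; _∈_; _⊆_; _≐_; _≬_; _∩_; _∪_)
open import Data.Bool.Base using (if_then_else_)

private variable
  a b c ℓ p : Level

module _ (G : Group c ℓ) where
  open Group G

  record IsSubgroup (H : Pred Carrier p) : Set (c ⊔ ℓ ⊔ p) where
    field
      resp : ∀ {x y} → x ≈ y → x ∈ H → y ∈ H
      ∙-closed : ∀ {x y} → x ∈ H → y ∈ H → x ∙ y ∈ H
      ε-closed : ε ∈ H
      ⁻¹-closed : ∀ {x} → x ∈ H → x ⁻¹ ∈ H

  NormalizedBy : Pred Carrier a → Pred Carrier b → Set (c ⊔ a ⊔ b)
  NormalizedBy P H = ∀ {g h} → g ∈ P → h ∈ H → g ∙ h ∙ g ⁻¹ ∈ H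

  record IsNormalSubgroup (H : Pred Carrier p) : Set (c ⊔ ℓ ⊔ p) where
    field
      isSubgroup : IsSubgroup H
      conj-closed : ∀ g {h} → h ∈ H → g ∙ h ∙ g ⁻¹ ∈ H
    open IsSubgroup isSubgroup public

  record Subgroup p : Set (c ⊔ ℓ ⊔ lsuc p) where
    field
      member : Pred Carrier p
      isSubgroup : IsSubgroup member
    open IsSubgroup isSubgroup public

  -- Finitely many left cosets s₁H, …, sₖH (sᵢ ∈ S) cover S.
  HasFiniteIndexIn : Pred Carrier a → Pred Carrier b → Set (c ⊔ a ⊔ b)
  HasFiniteIndexIn H S = H ⊆ S ×
    ∃[ k ] Σ (Vector Carrier k) λ s → (∀ i → s i ∈ S) ×
      (∀ {g} → g ∈ S → ∃[ i ] (s i) ⁻¹ ∙ g ∈ H)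

module _ {G : Group c ℓ} where
  open Group G

  _⊓_ : Subgroup G a → Subgroup G b → Subgroup G (a ⊔ b)
  H ⊓ K = record
    { member = H.member ∩ K.member
    ; isSubgroup = record
      { resp = λ e (h , k) → H.resp e h , K.resp e k
      ; ∙-closed = λ (h , k) (h′ , k′) → H.∙-closed h h′ , K.∙-closed k k′
      ; ε-closed = H.ε-closed , K.ε-closed
      ; ⁻¹-closed = λ (h , k) → H.⁻¹-closed h , K.⁻¹-closed k
      }
    } where module H = Subgroup H
            module K = Subgroup K

  subgroup⇒group : Subgroup G p → Group (c ⊔ p) ℓ
  subgroup⇒group H = record
    { Carrier = ∃ H.member
    ; _≈_ = λ x y → proj₁ x ≈ proj₁ y
    ; _∙_ = λ (x , x∈) (y , y∈) → x ∙ y , H.∙-closed x∈ y∈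
    ; ε = ε , H.ε-closed
    ; _⁻¹ = λ (x , x∈) → x ⁻¹ , H.⁻¹-closed x∈
    ; isGroup = record
      { isMonoid = record
        { isSemigroup = record
          { isMagma = record
            { isEquivalence = On.isEquivalence proj₁ isEquivalence
            ; ∙-cong = ∙-cong
            }
          ; assoc = λ _ _ _ → assoc _ _ _
          }
        ; identity = (λ _ → identityˡ _) , (λ _ → identityʳ _)
        }
      ; inverse = (λ _ → inverseˡ _) , (λ _ → inverseʳ _)
      ; ⁻¹-cong = ⁻¹-cong
      }
    } where module H = Subgroup H

-- H \ G: the same carrier, with x and y identified when H x = H y.
quotient : (G : Group c ℓ) {H : Pred (Group.Carrier G) p} → IsNormalSubgroup G H → Group c p
quotient G {H} N = record
  { Carrier = Carrier
  ; _≈_ = λ x y → x ∙ y ⁻¹ ∈ H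
  ; _∙_ = _∙_
  ; ε = ε
  ; _⁻¹ = _⁻¹
  ; isGroup = record
    { isMonoid = record
      { isSemigroup = record
        { isMagma = record
          { isEquivalence = record
            { refl = ≈⇒∼ ≈-refl
            ; sym = λ {x} {y} xy → resp (invert x y) (⁻¹-closed xy)
            ; trans = λ {x} {y} {z} xy yz → resp (telescope x y z) (∙-closed xy yz)
            }
          ; ∙-cong = λ {x} {y} {u} {v} xy uv →
              resp (product x y u v) (∙-closed (conj-closed x uv) xy)
          }
        ; assoc = λ x y z → ≈⇒∼ (assoc x y z)
        }
      ; identity = (λ x → ≈⇒∼ (identityˡ x)) , (λ x → ≈⇒∼ (identityʳ x))
      }
    ; inverse = (λ x → ≈⇒∼ (inverseˡ x)) , (λ x → ≈⇒∼ (inverseʳ x))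
    ; ⁻¹-cong = λ {x} {y} xy → resp (inverted x y) (⁻¹-closed (conj-closed (x ⁻¹) xy))
    }
  }
  where
  open Group G renaming (refl to ≈-refl; sym to ≈-sym; trans to ≈-trans)
  open IsNormalSubgroup N
  open GroupProperties G
  open SetoidReasoning setoid

  ≈⇒∼ : ∀ {x y} → x ≈ y → x ∙ y ⁻¹ ∈ H
  ≈⇒∼ {x} {y} e = resp (≈-sym (≈-trans (∙-congʳ e) (inverseʳ y))) ε-closed

  invert : ∀ x y → (x ∙ y ⁻¹) ⁻¹ ≈ y ∙ x ⁻¹
  invert x y = ≈-trans (⁻¹-anti-homo-∙ x (y ⁻¹)) (∙-congʳ (⁻¹-involutive y))

  cancel-middle : ∀ x y z → (x ∙ y ⁻¹) ∙ (y ∙ z) ≈ x ∙ z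
  cancel-middle x y z = begin
    (x ∙ y ⁻¹) ∙ (y ∙ z)   ≈⟨ assoc x (y ⁻¹) (y ∙ z) ⟩
    x ∙ (y ⁻¹ ∙ (y ∙ z))   ≈⟨ ∙-congˡ (assoc (y ⁻¹) y z) ⟨
    x ∙ ((y ⁻¹ ∙ y) ∙ z)   ≈⟨ ∙-congˡ (∙-congʳ (inverseˡ y)) ⟩
    x ∙ (ε ∙ z)            ≈⟨ ∙-congˡ (identityˡ z) ⟩
    x ∙ z                  ∎

  telescope : ∀ x y z → (x ∙ y ⁻¹) ∙ (y ∙ z ⁻¹) ≈ x ∙ z ⁻¹
  telescope x y z = cancel-middle x y (z ⁻¹)

  product : ∀ x y u v → (x ∙ (u ∙ v ⁻¹) ∙ x ⁻¹) ∙ (x ∙ y ⁻¹) ≈ (x ∙ u) ∙ (y ∙ v) ⁻¹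
  product x y u v = begin
    (x ∙ (u ∙ v ⁻¹) ∙ x ⁻¹) ∙ (x ∙ y ⁻¹)  ≈⟨ cancel-middle _ x (y ⁻¹) ⟩
    (x ∙ (u ∙ v ⁻¹)) ∙ y ⁻¹               ≈⟨ ∙-congʳ (assoc x u (v ⁻¹)) ⟨
    ((x ∙ u) ∙ v ⁻¹) ∙ y ⁻¹               ≈⟨ assoc (x ∙ u) (v ⁻¹) (y ⁻¹) ⟩
    (x ∙ u) ∙ (v ⁻¹ ∙ y ⁻¹)               ≈⟨ ∙-congˡ (⁻¹-anti-homo-∙ y v) ⟨
    (x ∙ u) ∙ (y ∙ v) ⁻¹                  ∎

  inverted : ∀ x y → (x ⁻¹ ∙ (x ∙ y ⁻¹) ∙ (x ⁻¹) ⁻¹) ⁻¹ ≈ x ⁻¹ ∙ (y ⁻¹) ⁻¹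
  inverted x y = begin
    (x ⁻¹ ∙ (x ∙ y ⁻¹) ∙ (x ⁻¹) ⁻¹) ⁻¹    ≈⟨ ⁻¹-cong (∙-congʳ (assoc (x ⁻¹) x (y ⁻¹))) ⟨
    ((x ⁻¹ ∙ x) ∙ y ⁻¹ ∙ (x ⁻¹) ⁻¹) ⁻¹    ≈⟨ ⁻¹-cong (∙-congʳ (∙-congʳ (inverseˡ x))) ⟩
    (ε ∙ y ⁻¹ ∙ (x ⁻¹) ⁻¹) ⁻¹             ≈⟨ ⁻¹-cong (∙-congʳ (identityˡ (y ⁻¹))) ⟩
    (y ⁻¹ ∙ (x ⁻¹) ⁻¹) ⁻¹                 ≈⟨ ⁻¹-anti-homo-∙ (y ⁻¹) ((x ⁻¹) ⁻¹) ⟩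
    ((x ⁻¹) ⁻¹) ⁻¹ ∙ (y ⁻¹) ⁻¹            ≈⟨ ∙-congʳ (⁻¹-involutive (x ⁻¹)) ⟩
    x ⁻¹ ∙ (y ⁻¹) ⁻¹                      ∎

record Action (G : Group a b) (S : Setoid c ℓ) : Set (a ⊔ b ⊔ c ⊔ ℓ) where
  private
    module G = Group G
    module S = Setoid S
  field
    act : G.Carrier → S.Carrier → S.Carrier
    act-cong : ∀ {g h x y} → g G.≈ h → x S.≈ y → act g x S.≈ act h y
    act-ε : ∀ x → act G.ε x S.≈ x
    act-∙ : ∀ g h x → act (g G.∙ h) x S.≈ act g (act h x)

  IsFree : Set (a ⊔ b ⊔ c ⊔ ℓ)
  IsFree = ∀ g x → act g x S.≈ x → g G.≈ G.ε

Matrix : Set a → ℕ → Set a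
Matrix A n = Fin n → Fin n → A

module Matrices (R : RawRing c ℓ) where
  open RawRing R
  open RawMonoidDefs +-rawMonoid using (sum) public
  open RawSemiringDefs rawSemiring using (_^_) public

  identity : ∀ {n} → Matrix Carrier n
  identity i j = if does (i ≟ j) then 1# else 0#

  -- Laplace expansion along the first row.
  det : ∀ {n} → Matrix Carrier n → Carrier
  det {zero} A = 1#
  det {suc n} A = sum λ j →
    (- 1#) ^ toℕ j * (A zero j * det (λ i k → A (suc i) (punchIn j k)))

  -- { A | Aᵀ S A = S , det A = 1 }
  SO : ∀ {n} → Matrix Carrier n → Pred (Matrix Carrier n) ℓ
  SO S A = (∀ i j → sum (λ k → sum (λ l → A k i * (S k l * A l j))) ≈ S i j)
         × det A ≈ 1#

  IsEigenvalue : ∀ {n} → Matrix Carrier n → Pred Carrier (c ⊔ ℓ)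
  IsEigenvalue {n} A z = Σ (Vector Carrier n) λ v →
    ¬ (∀ i → v i ≈ 0#) × (∀ i → sum (λ j → A i j * v j) ≈ z * v i)

  -- The subgroup of the unit group generated by a set S of units.
  data Generated (S : Pred Carrier p) : Pred Carrier (c ⊔ ℓ ⊔ p) where
    generator : ∀ {x} → x ∈ S → Generated S x
    one : Generated S 1#
    mul : ∀ {x y} → Generated S x → Generated S y → Generated S (x * y)
    inv : ∀ {x y} → Generated S x → x * y ≈ 1# → Generated S y
    resp : ∀ {x y} → x ≈ y → Generated S x → Generated S y

  TorsionFree : Pred Carrier p → Set (c ⊔ ℓ ⊔ p)
  TorsionFree S = ∀ {x} → x ∈ S → ∀ m → x ^ suc m ≈ 1# → x ≈ 1#

record ℝ : Set where
  field
    seq : ℕ → ℚ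
    cauchy : ∀ ε → 0ℚ ℚ.< ε → ∃[ N ] ∀ m n → N ℕ.≤ m → N ℕ.≤ n →
             ℚ.∣ seq m ℚ.- seq n ∣ ℚ.< ε
open ℝ

_≈ℝ_ : ℝ → ℝ → Set
x ≈ℝ y = ∀ ε → 0ℚ ℚ.< ε → ∃[ N ] ∀ n → N ℕ.≤ n → ℚ.∣ seq x n ℚ.- seq y n ∣ ℚ.< ε

-- The strict inequality ∣ x - y ∣ < ε between real numbers.
∣_-_∣<_ : ℝ → ℝ → ℚ → Set
∣ x - y ∣< ε = ∃[ δ ] δ ℚ.< ε × ∃[ N ] ∀ n → N ℕ.≤ n → ℚ.∣ seq x n ℚ.- seq y n ∣ ℚ.≤ δ

fromℚ : ℚ → ℝ
fromℚ q = record
  { seq = λ _ → q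
  ; cauchy = λ ε 0<ε → 0 , λ _ _ _ _ → subst (ℚ._< ε) (cong ℚ.∣_∣ (sym (ℚ.+-inverseʳ q))) 0<ε
  }

private
  half : ∀ {ε} → 0ℚ ℚ.< ε → 0ℚ ℚ.< ε ℚ.* ½
  half {ε} 0<ε = ℚ.positive⁻¹ (ε ℚ.* ½) {{ℚ.pos*pos⇒pos ε {{ℚ.positive 0<ε}} ½}}

  half+half : ∀ ε → ε ℚ.* ½ ℚ.+ ε ℚ.* ½ ≡ ε
  half+half ε = trans (sym (ℚ.*-distribˡ-+ ε ½ ½)) (ℚ.*-identityʳ ε)

  +-split : ∀ x y u v → (x ℚ.+ y) ℚ.- (u ℚ.+ v) ≡ (x ℚ.- u) ℚ.+ (y ℚ.- v)
  +-split = solve 4 (λ x y u v → (x :+ y) :- (u :+ v) := (x :- u) :+ (y :- v)) refl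
    where open +-*-Solver

  *-split : ∀ x y u v → (x ℚ.* y) ℚ.- (u ℚ.* v) ≡ x ℚ.* (y ℚ.- v) ℚ.+ (x ℚ.- u) ℚ.* v
  *-split = solve 4 (λ x y u v → (x :* y) :- (u :* v) := x :* (y :- v) :+ (x :- u) :* v) refl
    where open +-*-Solver

  neg-split : ∀ x y → (ℚ.- x) ℚ.- (ℚ.- y) ≡ ℚ.- (x ℚ.- y)
  neg-split = solve 2 (λ x y → (:- x) :- (:- y) := :- (x :- y)) refl
    where open +-*-Solver

  recover : ∀ x y → x ≡ y ℚ.+ (x ℚ.- y)
  recover = solve 2 (λ x y → x := y :+ (x :- y)) refl
    where open +-*-Solver

  triangle : ∀ {x y δ δ′} → ℚ.∣ x ∣ ℚ.< δ → ℚ.∣ y ∣ ℚ.< δ′ → ℚ.∣ x ℚ.+ y ∣ ℚ.< δ ℚ.+ δ′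
  triangle {x} {y} x< y< = ℚ.≤-<-trans (ℚ.∣p+q∣≤∣p∣+∣q∣ x y) (ℚ.+-mono-< x< y<)

  bounded : ∀ x → ∃[ B ] ℚ.Positive B × ∃[ N ] ∀ n → N ℕ.≤ n → ℚ.∣ seq x n ∣ ℚ.< B
  bounded x = B , pos , N , bound
    where
    N = proj₁ (cauchy x 1ℚ (ℚ.positive⁻¹ 1ℚ))
    B = ℚ.∣ seq x N ∣ ℚ.+ 1ℚ
    pos : ℚ.Positive B
    pos = ℚ.nonNeg+pos⇒pos ℚ.∣ seq x N ∣ {{ℚ.∣-∣-nonNeg (seq x N)}} 1ℚ
    bound : ∀ n → N ℕ.≤ n → ℚ.∣ seq x n ∣ ℚ.< B
    bound n N≤n = subst (λ z → ℚ.∣ z ∣ ℚ.< B) (sym (recover (seq x n) (seq x N)))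
      (ℚ.≤-<-trans (ℚ.∣p+q∣≤∣p∣+∣q∣ (seq x N) (seq x n ℚ.- seq x N))
        (ℚ.+-monoʳ-< ℚ.∣ seq x N ∣ (proj₂ (cauchy x 1ℚ (ℚ.positive⁻¹ 1ℚ)) n N N≤n ℕ.≤-refl)))

  scaled : ∀ {x y B δ} → .{{_ : ℚ.Positive B}} → ℚ.∣ x ∣ ℚ.< B → ℚ.∣ y ∣ ℚ.< δ →
           ℚ.∣ x ℚ.* y ∣ ℚ.< B ℚ.* δ
  scaled {x} {y} {B} {δ} x< y< = subst (ℚ._< B ℚ.* δ) (sym (ℚ.∣p*q∣≡∣p∣*∣q∣ x y))
    (ℚ.≤-<-trans (ℚ.*-monoʳ-≤-nonNeg ℚ.∣ y ∣ {{ℚ.∣-∣-nonNeg y}} (ℚ.<⇒≤ x<))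
                 (ℚ.*-monoʳ-<-pos B y<))

_+ℝ_ : ℝ → ℝ → ℝ
x +ℝ y = record
  { seq = λ n → seq x n ℚ.+ seq y n
  ; cauchy = λ ε 0<ε →
      let (Nx , cx) = cauchy x (ε ℚ.* ½) (half 0<ε)
          (Ny , cy) = cauchy y (ε ℚ.* ½) (half 0<ε)
      in Nx ℕ.⊔ Ny , λ m n N≤m N≤n →
        subst₂ ℚ._<_ (cong ℚ.∣_∣ (sym (+-split (seq x m) (seq y m) (seq x n) (seq y n))))
                     (half+half ε)
          (triangle (cx m n (ℕ.m⊔n≤o⇒m≤o Nx Ny N≤m) (ℕ.m⊔n≤o⇒m≤o Nx Ny N≤n))
                    (cy m n (ℕ.m⊔n≤o⇒n≤o Nx Ny N≤m) (ℕ.m⊔n≤o⇒n≤o Nx Ny N≤n)))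
  }

-ℝ_ : ℝ → ℝ
-ℝ x = record
  { seq = λ n → ℚ.- seq x n
  ; cauchy = λ ε 0<ε → let (N , cx) = cauchy x ε 0<ε in N , λ m n N≤m N≤n →
      subst (ℚ._< ε) (trans (sym (ℚ.∣-p∣≡∣p∣ (seq x m ℚ.- seq x n)))
                            (cong ℚ.∣_∣ (sym (neg-split (seq x m) (seq x n)))))
            (cx m n N≤m N≤n)
  }

_*ℝ_ : ℝ → ℝ → ℝ
x *ℝ y = record
  { seq = λ n → seq x n ℚ.* seq y n
  ; cauchy = λ ε 0<ε →
      let (Bx , Bx>0 , Kx , bx) = bounded x
          (By , By>0 , Ky , by) = bounded y
          (δx , δx>0 , ex) = share ε 0<ε By By>0
          (δy , δy>0 , ey) = share ε 0<ε Bx Bx>0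
          (Nx , cx) = cauchy x δx δx>0
          (Ny , cy) = cauchy y δy δy>0
          K = Kx ℕ.⊔ Ky
          M = Nx ℕ.⊔ Ny
      in K ℕ.⊔ M , λ m n N≤m N≤n →
        let K≤m = ℕ.m⊔n≤o⇒m≤o K M N≤m
            K≤n = ℕ.m⊔n≤o⇒m≤o K M N≤n
            M≤m = ℕ.m⊔n≤o⇒n≤o K M N≤m
            M≤n = ℕ.m⊔n≤o⇒n≤o K M N≤n
            xm = seq x m ; ym = seq y m ; xn = seq x n ; yn = seq y n
            left = scaled {xm} {ym ℚ.- yn} {{Bx>0}}
                     (bx m (ℕ.m⊔n≤o⇒m≤o Kx Ky K≤m))
                     (cy m n (ℕ.m⊔n≤o⇒n≤o Nx Ny M≤m) (ℕ.m⊔n≤o⇒n≤o Nx Ny M≤n))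
            right = scaled {yn} {xm ℚ.- xn} {{By>0}}
                     (by n (ℕ.m⊔n≤o⇒n≤o Kx Ky K≤n))
                     (cx m n (ℕ.m⊔n≤o⇒m≤o Nx Ny M≤m) (ℕ.m⊔n≤o⇒m≤o Nx Ny M≤n))
            right′ = subst (λ z → ℚ.∣ z ∣ ℚ.< By ℚ.* δx) (ℚ.*-comm yn (xm ℚ.- xn)) right
        in subst₂ ℚ._<_ (cong ℚ.∣_∣ (sym (*-split xm ym xn yn))) (half+half ε)
             (triangle (subst (ℚ.∣ xm ℚ.* (ym ℚ.- yn) ∣ ℚ.<_) ey left)
                       (subst (ℚ.∣ (xm ℚ.- xn) ℚ.* yn ∣ ℚ.<_) ex right′))
  }
  where
  share : ∀ ε → 0ℚ ℚ.< ε → ∀ B → ℚ.Positive B → ∃[ δ ] 0ℚ ℚ.< δ × B ℚ.* δ ≡ ε ℚ.* ½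
  share ε 0<ε B B>0 = B⁻¹ ℚ.* (ε ℚ.* ½) , positive , eq
    where
    instance
      _ = B>0
      _ = ℚ.pos⇒nonZero B
    B⁻¹ = ℚ.1/ B
    positive = ℚ.positive⁻¹ (B⁻¹ ℚ.* (ε ℚ.* ½))
      {{ℚ.pos*pos⇒pos B⁻¹ {{ℚ.1/pos⇒pos B}} (ε ℚ.* ½) {{ℚ.positive (half 0<ε)}}}}
    eq : B ℚ.* (B⁻¹ ℚ.* (ε ℚ.* ½)) ≡ ε ℚ.* ½
    eq = trans (sym (ℚ.*-assoc B B⁻¹ (ε ℚ.* ½)))
               (trans (cong (ℚ._* (ε ℚ.* ½)) (ℚ.*-inverseʳ B)) (ℚ.*-identityˡ (ε ℚ.* ½)))

ℝ-rawRing : RawRing 0ℓ 0ℓ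
ℝ-rawRing = record
  { Carrier = ℝ ; _≈_ = _≈ℝ_ ; _+_ = _+ℝ_ ; _*_ = _*ℝ_ ; -_ = -ℝ_
  ; 0# = fromℚ 0ℚ ; 1# = fromℚ 1ℚ }

-- ℂ = ℝ[i], with (x , y) standing for x + iy.
ℂ : Set
ℂ = ℝ × ℝ

ℂ-rawRing : RawRing 0ℓ 0ℓ
ℂ-rawRing = record
  { Carrier = ℂ
  ; _≈_ = λ (x , y) (u , v) → x ≈ℝ u × y ≈ℝ v
  ; _+_ = λ (x , y) (u , v) → x +ℝ u , y +ℝ v
  ; _*_ = λ (x , y) (u , v) → (x *ℝ u) +ℝ (-ℝ (y *ℝ v)) , (x *ℝ v) +ℝ (y *ℝ u)
  ; -_ = λ (x , y) → -ℝ x , -ℝ y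
  ; 0# = fromℚ 0ℚ , fromℚ 0ℚ
  ; 1# = fromℚ 1ℚ , fromℚ 0ℚ
  }

module ℚ-Mat = Matrices ℚ.+-*-rawRing
module ℝ-Mat = Matrices ℝ-rawRing
module ℂ-Mat = Matrices ℂ-rawRing

IsNeatMatrix : ∀ {n} → Pred (Matrix ℚ n) 0ℓ
IsNeatMatrix A = ℂ-Mat.TorsionFree
  (ℂ-Mat.Generated (ℂ-Mat.IsEigenvalue λ i j → fromℚ (A i j) , fromℚ 0ℚ))

module _ {n : ℕ} where
  IsOpen : Pred (Matrix ℝ n) 0ℓ → Set
  IsOpen U = ∀ {A} → A ∈ U → ∃[ ε ] 0ℚ ℚ.< ε ×
    (∀ B → (∀ i j → ∣ A i j - B i j ∣< ε) → B ∈ U)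

  -- Positive form of connectedness: two relatively open inhabited subsets
  -- covering C have a common point in C.
  IsConnected : Pred (Matrix ℝ n) 0ℓ → Set₁
  IsConnected C = ∀ {U W} → IsOpen U → IsOpen W → C ⊆ U ∪ W →
    C ≬ U → C ≬ W → C ≬ (U ∩ W)

  IdentityComponent : Pred (Matrix ℝ n) 0ℓ → Pred (Matrix ℝ n) (lsuc 0ℓ)
  IdentityComponent H A = Σ (Pred (Matrix ℝ n) 0ℓ) λ C →
    C ⊆ H × IsConnected C × ℝ-Mat.identity ∈ C × A ∈ C

VectorSpace : Set₁
VectorSpace = LeftModule ℚ.+-*-ring 0ℓ 0ℓ

module LinearAlgebra (V : VectorSpace) where
  open LeftModule V public
  open RawMonoidDefs +ᴹ-rawMonoid using () renaming (sum to sumᴹ) public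
  open LeftModuleMorphisms rawLeftModule rawLeftModule using (IsLeftModuleIsomorphism) public

  vectorSetoid : Setoid 0ℓ 0ℓ
  vectorSetoid = record { isEquivalence = ≈ᴹ-isEquivalence }

  infixl 6 _-ᴹ_
  _-ᴹ_ : Carrierᴹ → Carrierᴹ → Carrierᴹ
  v -ᴹ w = v +ᴹ (-ᴹ w)

  combination : ∀ {n} → Vector ℚ n → Vector Carrierᴹ n → Carrierᴹ
  combination c x = sumᴹ λ i → c i *ₗ x i

  Span : ∀ {n} → Vector Carrierᴹ n → Pred Carrierᴹ 0ℓ
  Span x v = ∃[ c ] v ≈ᴹ combination c x

  ℤ-Span : ∀ {n} → Vector Carrierᴹ n → Pred Carrierᴹ 0ℓ
  ℤ-Span {n} x v = Σ (Vector ℤ n) λ z → v ≈ᴹ combination (λ i → z i ℚ./ 1) x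

  LinearlyIndependent : ∀ {n} → Vector Carrierᴹ n → Set
  LinearlyIndependent x = ∀ c → combination c x ≈ᴹ 0ᴹ → ∀ i → c i ≡ 0ℚ

  record IsBasis {n} (x : Vector Carrierᴹ n) : Set where
    field
      independent : LinearlyIndependent x
      spanning : ∀ v → v ∈ Span x

  HasDimension : Pred Carrierᴹ 0ℓ → ℕ → Set
  HasDimension U d = Σ (Vector Carrierᴹ d) λ x → LinearlyIndependent x × U ≐ Span x

  record Automorphism : Set where
    field
      ⟦_⟧ : Carrierᴹ → Carrierᴹ
      isIsomorphism : IsLeftModuleIsomorphism ⟦_⟧
    open IsLeftModuleIsomorphism isIsomorphism public
  open Automorphism public using (⟦_⟧)

  GL : Group 0ℓ 0ℓ
  GL = record
    { Carrier = Automorphism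
    ; _≈_ = λ f g → ∀ v → ⟦ f ⟧ v ≈ᴹ ⟦ g ⟧ v
    ; _∙_ = λ f g → record
        { ⟦_⟧ = ⟦ f ⟧ ∘ ⟦ g ⟧
        ; isIsomorphism = Composition.isLeftModuleIsomorphism ≈ᴹ-trans
            (Automorphism.isIsomorphism g) (Automorphism.isIsomorphism f)
        }
    ; ε = record
        { ⟦_⟧ = id
        ; isIsomorphism = Identity.isLeftModuleIsomorphism rawLeftModule ≈ᴹ-refl
        }
    ; _⁻¹ = inverse
    ; isGroup = record
      { isMonoid = record
        { isSemigroup = record
          { isMagma = record
            { isEquivalence = record
              { refl = λ _ → ≈ᴹ-refl
              ; sym = λ f≈g v → ≈ᴹ-sym (f≈g v)
              ; trans = λ f≈g g≈h v → ≈ᴹ-trans (f≈g v) (g≈h v)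
              }
            ; ∙-cong = λ {f} {g} {h} {k} f≈g h≈k v →
                ≈ᴹ-trans (f≈g (⟦ h ⟧ v)) (Automorphism.⟦⟧-cong g (h≈k v))
            }
          ; assoc = λ _ _ _ _ → ≈ᴹ-refl
          }
        ; identity = (λ _ _ → ≈ᴹ-refl) , (λ _ _ → ≈ᴹ-refl)
        }
      ; inverse = (λ f v → inverseˡ f v) , inverseʳ
      ; ⁻¹-cong = λ {f} {g} f≈g v → Automorphism.injective f
          (≈ᴹ-trans (inverseʳ f v)
            (≈ᴹ-sym (≈ᴹ-trans (f≈g (⟦ inverse g ⟧ v)) (inverseʳ g v))))
      }
    }
    where
    module _ (f : Automorphism) where
      open Automorphism f using (⟦⟧-cong; +ᴹ-homo; *ₗ-homo; 0ᴹ-homo; -ᴹ-homo; injective; surjective)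

      pre : Carrierᴹ → Carrierᴹ
      pre v = proj₁ (surjective v)

      inverseʳ : ∀ v → ⟦ f ⟧ (pre v) ≈ᴹ v
      inverseʳ v = proj₂ (surjective v) ≈ᴹ-refl

      inverseˡ : ∀ v → pre (⟦ f ⟧ v) ≈ᴹ v
      inverseˡ v = injective (inverseʳ (⟦ f ⟧ v))

      pre-cong : ∀ {v w} → v ≈ᴹ w → pre v ≈ᴹ pre w
      pre-cong {v} {w} e = injective
        (≈ᴹ-trans (inverseʳ v) (≈ᴹ-trans e (≈ᴹ-sym (inverseʳ w))))

      inverse : Automorphism
      inverse = record
        { ⟦_⟧ = pre
        ; isIsomorphism = record
          { isLeftModuleMonomorphism = record
            { isLeftModuleHomomorphism = record
              { +ᴹ-isGroupHomomorphism = record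
                { isMonoidHomomorphism = record
                  { isMagmaHomomorphism = record
                    { isRelHomomorphism = record { cong = pre-cong }
                    ; homo = λ v w → injective (≈ᴹ-trans (inverseʳ (v +ᴹ w))
                        (≈ᴹ-sym (≈ᴹ-trans (+ᴹ-homo (pre v) (pre w))
                          (+ᴹ-cong (inverseʳ v) (inverseʳ w)))))
                    }
                  ; ε-homo = injective (≈ᴹ-trans (inverseʳ 0ᴹ) (≈ᴹ-sym 0ᴹ-homo))
                  }
                ; ⁻¹-homo = λ v → injective (≈ᴹ-trans (inverseʳ (-ᴹ v))
                    (≈ᴹ-sym (≈ᴹ-trans (-ᴹ-homo (pre v)) (-ᴹ‿cong (inverseʳ v)))))
                }
              ; *ₗ-homo = λ c v → injective (≈ᴹ-trans (inverseʳ (c *ₗ v))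
                  (≈ᴹ-sym (≈ᴹ-trans (*ₗ-homo c (pre v)) (*ₗ-cong refl (inverseʳ v)))))
              }
            ; injective = λ {v} {w} e → ≈ᴹ-trans (≈ᴹ-sym (inverseʳ v))
                (≈ᴹ-trans (⟦⟧-cong e) (inverseʳ w))
            }
          ; surjective = λ v → ⟦ f ⟧ v , λ e → ≈ᴹ-trans (pre-cong e) (inverseˡ v)
          }
        }

  open Group GL public using () renaming (_∙_ to _∙ᴳ_; _⁻¹ to _⁻¹ᴳ)

  image : Automorphism → Pred Carrierᴹ 0ℓ → Pred Carrierᴹ 0ℓ
  image g U w = ∃[ v ] v ∈ U × w ≈ᴹ ⟦ g ⟧ v

  -- (g - 1)ᵏ v
  [_-1]^_ : Automorphism → ℕ → Carrierᴹ → Carrierᴹ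
  ([ g -1]^ zero) v = v
  ([ g -1]^ suc k) v = ⟦ g ⟧ (([ g -1]^ k) v) -ᴹ ([ g -1]^ k) v

  IsUnipotent : Pred Automorphism 0ℓ
  IsUnipotent g = ∃[ k ] ∀ v → ([ g -1]^ k) v ≈ᴹ 0ᴹ

  record IsNormalUnipotentIn (P H : Pred Automorphism 0ℓ) : Set where
    field
      isSubgroup : IsSubgroup GL H
      ⊆P : H ⊆ P
      normalized : NormalizedBy GL P H
      unipotent : H ⊆ IsUnipotent

  -- P and H are groups of rational points.  The unipotent radical is usually
  -- taken among closed connected subgroups; this is no restriction, since in
  -- characteristic 0 the Zariski closure of a unipotent group is unipotent and
  -- connected, and a connected group over ℚ has dense rational points.
  record IsUnipotentRadicalOf (P H : Pred Automorphism 0ℓ) : Set₁ where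
    field
      normalUnipotent : IsNormalUnipotentIn P H
      largest : ∀ {K} → IsNormalUnipotentIn P K → K ⊆ H
    open IsNormalUnipotentIn normalUnipotent public

_^ᵛ : ℕ → VectorSpace
n ^ᵛ = record
  { isLeftModule = record
    { isLeftSemimodule = record
      { +ᴹ-isCommutativeMonoid = AbelianGroup.isCommutativeMonoid ℚⁿ
      ; isPreleftSemimodule = record
        { *ₗ-cong = λ c≡d x≡y i → *-cong c≡d (x≡y i)
        ; *ₗ-zeroˡ = λ x i → zeroˡ (x i)
        ; *ₗ-distribʳ = λ x c d i → distribʳ (x i) c d
        ; *ₗ-identityˡ = λ x i → *-identityˡ (x i)
        ; *ₗ-assoc = λ c d x i → *-assoc c d (x i)
        ; *ₗ-zeroʳ = λ c i → zeroʳ c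
        ; *ₗ-distribˡ = λ c x y i → distribˡ c (x i) (y i)
        }
      }
    ; -ᴹ‿cong = AbelianGroup.⁻¹-cong ℚⁿ
    ; -ᴹ‿inverse = AbelianGroup.inverse ℚⁿ
    }
  ; _*ₗ_ = λ c x i → c ℚ.* x i
  }
  where
  open Ring ℚ.+-*-ring
  ℚⁿ = Pointwise.abelianGroup (Fin n) (Ring.+-abelianGroup ℚ.+-*-ring)

module _ {n : ℕ} (β : Matrix ℚ n) where
  IsSymmetric : Set
  IsSymmetric = ∀ i j → β i j ≡ β j i

  IsPositiveSemidefinite : Set
  IsPositiveSemidefinite = ∀ (c : Vector ℚ n) →
    0ℚ ℚ.≤ ℚ-Mat.sum (λ i → ℚ-Mat.sum (λ j → c i ℚ.* (β i j ℚ.* c j)))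

  HasRank : ℕ → Set
  HasRank r = HasDimension (Span β) r
    where open LinearAlgebra (n ^ᵛ)

-- A chosen basis is part of the structure, to identify automorphisms with
-- matrices; determinants, eigenvalues and the identity component below do
-- not depend on it.
record QuadraticSpace (p q : ℕ) : Set₁ where
  field
    space : VectorSpace
  open LinearAlgebra space public
  field
    ⟪_,_⟫ : Carrierᴹ → Carrierᴹ → ℚ
    ⟪⟫-cong : ∀ {u v w x} → u ≈ᴹ v → w ≈ᴹ x → ⟪ u , w ⟫ ≡ ⟪ v , x ⟫
    ⟪⟫-+ : ∀ u v w → ⟪ u +ᴹ v , w ⟫ ≡ ⟪ u , w ⟫ ℚ.+ ⟪ v , w ⟫
    ⟪⟫-* : ∀ c v w → ⟪ c *ₗ v , w ⟫ ≡ c ℚ.* ⟪ v , w ⟫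
    ⟪⟫-sym : ∀ v w → ⟪ v , w ⟫ ≡ ⟪ w , v ⟫
    nondegenerate : ∀ v → (∀ w → ⟪ v , w ⟫ ≡ 0ℚ) → v ≈ᴹ 0ᴹ
    basis : Vector Carrierᴹ (p ℕ.+ q)
    isBasis : IsBasis basis
    b⁺ : Vector Carrierᴹ p
    b⁻ : Vector Carrierᴹ q
    diagonalizing : IsBasis (b⁺ ++ b⁻)
    orthogonal : ∀ i j → i ≢ j → ⟪ (b⁺ ++ b⁻) i , (b⁺ ++ b⁻) j ⟫ ≡ 0ℚ
    positive : ∀ i → 0ℚ ℚ.< ⟪ b⁺ i , b⁺ i ⟫
    negative : ∀ i → ⟪ b⁻ i , b⁻ i ⟫ ℚ.< 0ℚ

  coordinates : Carrierᴹ → Vector ℚ (p ℕ.+ q)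
  coordinates v = proj₁ (IsBasis.spanning isBasis v)

  matrix : Automorphism → Matrix ℚ (p ℕ.+ q)
  matrix g i j = coordinates (⟦ g ⟧ (basis j)) i

  SO : Pred Automorphism 0ℓ
  SO g = (∀ v w → ⟪ ⟦ g ⟧ v , ⟦ g ⟧ w ⟫ ≡ ⟪ v , w ⟫) × ℚ-Mat.det (matrix g) ≡ 1ℚ

  -- The rational automorphisms in the identity component of SO(V)(ℝ), where
  -- real points are matrices with respect to the chosen basis.
  G₀ : Pred Automorphism (lsuc 0ℓ)
  G₀ g = IdentityComponent (ℝ-Mat.SO λ i j → fromℚ ⟪ basis i , basis j ⟫)
                           (λ i j → fromℚ (matrix g i j))

  IsNeat : Pred Automorphism 0ℓ → Set
  IsNeat Γ = ∀ {γ} → γ ∈ Γ → IsNeatMatrix (matrix γ)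

  IsFullLattice : Pred Carrierᴹ 0ℓ → Set
  IsFullLattice L = Σ (Vector Carrierᴹ (p ℕ.+ q)) λ b → IsBasis b × L ≐ ℤ-Span b

  _# : Pred Carrierᴹ 0ℓ → Pred Carrierᴹ 0ℓ
  (L #) v = ∀ {w} → w ∈ L → Σ ℤ λ z → ⟪ v , w ⟫ ≡ z ℚ./ 1

  -- An element of G₀(ℝ) preserving a full lattice of V is rational, so no
  -- real automorphisms are lost here.
  Stabilizer : Pred Carrierᴹ 0ℓ → Pred Automorphism (lsuc 0ℓ)
  Stabilizer L g = g ∈ G₀ × image g L ≐ L

  ActsTriviallyOnDiscriminant : Pred Carrierᴹ 0ℓ → Pred Automorphism 0ℓ → Set
  ActsTriviallyOnDiscriminant L Γ =
    ∀ {γ v} → γ ∈ Γ → v ∈ (L #) → ⟦ γ ⟧ v -ᴹ v ∈ L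

  IsIsotropicLine : Pred Carrierᴹ 0ℓ → Set
  IsIsotropicLine ℓ = HasDimension ℓ 1 × (∀ {v} → v ∈ ℓ → ⟪ v , v ⟫ ≡ 0ℚ)

  record RepresentsCusps {r} (Γ : Pred Automorphism 0ℓ) (ℓ : Vector (Pred Carrierᴹ 0ℓ) r) : Set₁ where
    field
      isotropic : ∀ j → IsIsotropicLine (ℓ j)
      complete : ∀ {m} → IsIsotropicLine m → ∃[ j ] ∃[ γ ] γ ∈ Γ × image γ (ℓ j) ≐ m
      distinct : ∀ {j k γ} → γ ∈ Γ → image γ (ℓ j) ≐ ℓ k → j ≡ k

  Parabolic : Pred Carrierᴹ 0ℓ → Pred Automorphism 0ℓ
  Parabolic ℓ g = g ∈ SO × image g ℓ ≐ ℓ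

  Fixing : Subgroup GL 0ℓ → Pred Carrierᴹ 0ℓ → Pred Automorphism 0ℓ
  Fixing N U g = g ∈ Subgroup.member N × (∀ {u} → u ∈ U → ⟦ g ⟧ u ≈ᴹ u)

  Radical : ∀ {n} → Vector Carrierᴹ n → Pred Carrierᴹ 0ℓ
  Radical X v = v ∈ Span X × (∀ {w} → w ∈ Span X → ⟪ v , w ⟫ ≡ 0ℚ)

  module _ {n} (β : Matrix ℚ n) (ℓ : Pred Carrierᴹ 0ℓ) where
    open VectorEquality vectorSetoid using (≋-setoid)

    Ω : Pred (Vector Carrierᴹ n) 0ℓ
    Ω X = (∀ i j → ½ ℚ.* ⟪ X i , X j ⟫ ≡ β i j) × Radical X ≐ ℓ

    Ω-spanning : Pred Carrierᴹ 0ℓ → Pred (Vector Carrierᴹ n) 0ℓ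
    Ω-spanning U X = X ∈ Ω × Span X ≐ U

    ΩSetoid : Setoid 0ℓ 0ℓ
    ΩSetoid = On.setoid (≋-setoid n) (proj₁ {B = Ω})

    Ω-spanningSetoid : Pred Carrierᴹ 0ℓ → Setoid 0ℓ 0ℓ
    Ω-spanningSetoid U = On.setoid (≋-setoid n) (proj₁ {B = Ω-spanning U})

    forgetSpan : ∀ {U} → ∃ (Ω-spanning U) → ∃ Ω
    forgetSpan (X , X∈Ω , _) = X , X∈Ω

{-# OPTIONS --safe #-}
-- An element g of the unipotent radical is a unipotent isometry stabilizing the
-- isotropic line ℓ.  Since V has signature (p , 1), ℓ^⊥ / ℓ is anisotropic, and
-- a unipotent isometry of an anisotropic space is trivial: if u = (g - 1) x and
-- (g - 1) u ∈ ℓ, then (u , u) = 0, so u ∈ ℓ.  Hence (g - 1) ℓ^⊥ ⊆ ℓ, and g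
-- preserves every U with ℓ ⊆ U ⊆ ℓ^⊥; this makes Γᵤ normal and lets Γⱼ act on the
-- tuples spanning U.  An element fixing a spanning tuple of U fixes U pointwise.
module Submission where

open import Defs
open import Algebra.Bundles using (Group; Ring)
import Algebra.Properties.CommutativeMonoid.Sum as CommutativeMonoidSum
import Algebra.Properties.Group as GroupProperties
import Algebra.Properties.Semiring.Sum as SemiringSum
open import Data.Fin.Base using (Fin; zero; suc; splitAt; punchIn)
open import Data.Fin.Properties using (punchInᵢ≢i)
open import Data.Nat.Base as ℕ using (ℕ; zero; suc; _≤_; _∸_)
open import Data.Product.Base using (Σ; ∃-syntax; _×_; _,_; proj₁; proj₂)
open import Data.Rational.Base as ℚ using (ℚ; 0ℚ; 1ℚ; ½)
import Data.Rational.Properties as ℚ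
open import Data.Sum.Base using (_⊎_; inj₁; inj₂)
open import Data.Vec.Functional using (Vector; _++_)
open import Function.Base using (_∘_)
open import Level using (0ℓ)
open import Relation.Binary.Bundles using (module Setoid)
open import Relation.Binary.PropositionalEquality using (_≡_; _≢_; refl; sym; trans; cong; cong₂; module ≡-Reasoning)
import Relation.Binary.Reasoning.Setoid as SetoidReasoning
open import Relation.Nullary using (¬_; contradiction; yes; no)
open import Relation.Unary using (Pred; _∈_; _⊆_; _≐_; _∩_; _⊢_)

private
  module ℚΣ = SemiringSum (Ring.semiring ℚ.+-*-ring)
  module ℚ+ = GroupProperties ℚ.+-0-group

*-nonzero-cancel : ∀ p {q} → q ≢ 0ℚ → p ℚ.* q ≡ 0ℚ → p ≡ 0ℚ
*-nonzero-cancel p {q} q≢0 pq≡0 = begin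
  p                        ≡⟨ ℚ.*-identityʳ p ⟨
  p ℚ.* 1ℚ                 ≡⟨ cong (p ℚ.*_) (ℚ.*-inverseʳ q) ⟨
  p ℚ.* (q ℚ.* ℚ.1/ q)     ≡⟨ ℚ.*-assoc p q (ℚ.1/ q) ⟨
  p ℚ.* q ℚ.* ℚ.1/ q       ≡⟨ cong (ℚ._* ℚ.1/ q) pq≡0 ⟩
  0ℚ ℚ.* ℚ.1/ q            ≡⟨ ℚ.*-zeroˡ (ℚ.1/ q) ⟩
  0ℚ                       ∎
  where
  open ≡-Reasoning
  instance _ = ℚ.≢-nonZero q≢0

square-nonneg : ∀ p → ℚ.NonNegative (p ℚ.* p)
square-nonneg p with ℚ.≤-total 0ℚ p
... | inj₁ 0≤p = ℚ.nonNeg*nonNeg⇒nonNeg p {{ℚ.nonNegative 0≤p}} p {{ℚ.nonNegative 0≤p}}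
... | inj₂ p≤0 = ℚ.nonPos*nonPos⇒nonPos p {{ℚ.nonPositive p≤0}} p {{ℚ.nonPositive p≤0}}

square≡0 : ∀ p → p ℚ.* p ≡ 0ℚ → p ≡ 0ℚ
square≡0 p pp≡0 with p ℚ.≟ 0ℚ
... | yes p≡0 = p≡0
... | no p≢0 = *-nonzero-cancel p p≢0 pp≡0

sum-nonneg : ∀ {n} (f : Vector ℚ n) → (∀ i → 0ℚ ℚ.≤ f i) → 0ℚ ℚ.≤ ℚΣ.sum f
sum-nonneg {zero} f 0≤f = ℚ.≤-refl
sum-nonneg {suc n} f 0≤f = ℚ.+-mono-≤ (0≤f zero) (sum-nonneg (f ∘ suc) (0≤f ∘ suc))

nonneg-+≡0 : ∀ {x y} → 0ℚ ℚ.≤ x → 0ℚ ℚ.≤ y → x ℚ.+ y ≡ 0ℚ → x ≡ 0ℚ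
nonneg-+≡0 {x} {y} 0≤x 0≤y x+y≡0 = ℚ.≤-antisym
  (ℚ.≤-trans (ℚ.≤-reflexive (sym (ℚ.+-identityʳ x)))
    (ℚ.≤-trans (ℚ.+-monoʳ-≤ x 0≤y) (ℚ.≤-reflexive x+y≡0)))
  0≤x

sum-nonneg≡0 : ∀ {n} (f : Vector ℚ n) → (∀ i → 0ℚ ℚ.≤ f i) →
               ℚΣ.sum f ≡ 0ℚ → ∀ i → f i ≡ 0ℚ
sum-nonneg≡0 f 0≤f e zero =
  nonneg-+≡0 (0≤f zero) (sum-nonneg (f ∘ suc) (0≤f ∘ suc)) e
sum-nonneg≡0 f 0≤f e (suc i) = sum-nonneg≡0 (f ∘ suc) (0≤f ∘ suc)
  (nonneg-+≡0 (sum-nonneg (f ∘ suc) (0≤f ∘ suc)) (0≤f zero)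
    (trans (ℚ.+-comm (ℚΣ.sum (f ∘ suc)) (f zero)) e)) i

sum-punctured : ∀ {n} (f : Vector ℚ n) i → (∀ k → k ≢ i → f k ≡ 0ℚ) → ℚΣ.sum f ≡ f i
sum-punctured {suc n} f i f≡0 = begin
  ℚΣ.sum f                            ≡⟨ ℚΣ.sum-remove {i = i} f ⟩
  f i ℚ.+ ℚΣ.sum (λ k → f (punchIn i k)) ≡⟨ cong (f i ℚ.+_)
    (trans (ℚΣ.sum-cong-≗ (λ k → f≡0 (punchIn i k) (punchInᵢ≢i i k))) (ℚΣ.sum-replicate-zero n)) ⟩
  f i ℚ.+ 0ℚ                          ≡⟨ ℚ.+-identityʳ (f i) ⟩
  f i                                 ∎
  where open ≡-Reasoning

module Combinations (V : VectorSpace) where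
  open LinearAlgebra V
  open Automorphism using (⟦⟧-cong; +ᴹ-homo; *ₗ-homo; 0ᴹ-homo)
  open CommutativeMonoidSum +ᴹ-commutativeMonoid using (sum-cong-≋; ∑-distrib-+; sum-replicate-zero)

  combination-cong : ∀ {n} {c d : Vector ℚ n} {x y : Vector Carrierᴹ n} →
                     (∀ i → c i ≡ d i) → (∀ i → x i ≈ᴹ y i) → combination c x ≈ᴹ combination d y
  combination-cong c≡d x≈y = sum-cong-≋ (λ i → *ₗ-cong (c≡d i) (x≈y i))

  combination-0 : ∀ {n} {c : Vector ℚ n} (x : Vector Carrierᴹ n) →
                  (∀ i → c i ≡ 0ℚ) → combination c x ≈ᴹ 0ᴹ
  combination-0 {n} x c≡0 = ≈ᴹ-trans
    (sum-cong-≋ (λ i → ≈ᴹ-trans (*ₗ-cong (c≡0 i) ≈ᴹ-refl) (*ₗ-zeroˡ (x i))))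
    (sum-replicate-zero n)

  combination-+ : ∀ {n} (c d : Vector ℚ n) x →
                  combination (λ i → c i ℚ.+ d i) x ≈ᴹ combination c x +ᴹ combination d x
  combination-+ c d x = ≈ᴹ-trans (sum-cong-≋ (λ i → *ₗ-distribʳ (x i) (c i) (d i)))
    (∑-distrib-+ (λ i → c i *ₗ x i) (λ i → d i *ₗ x i))

  ⟦⟧-combination : ∀ g {n} (c : Vector ℚ n) x →
                   ⟦ g ⟧ (combination c x) ≈ᴹ combination c (λ i → ⟦ g ⟧ (x i))
  ⟦⟧-combination g {zero} c x = 0ᴹ-homo g
  ⟦⟧-combination g {suc n} c x = ≈ᴹ-trans (+ᴹ-homo g _ _)
    (+ᴹ-cong (*ₗ-homo g (c zero) (x zero)) (⟦⟧-combination g (c ∘ suc) (x ∘ suc)))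

  span-resp : ∀ {n} {x : Vector Carrierᴹ n} {v w} → v ≈ᴹ w → v ∈ Span x → w ∈ Span x
  span-resp v≈w (c , e) = c , ≈ᴹ-trans (≈ᴹ-sym v≈w) e

  span-+ : ∀ {n} {x : Vector Carrierᴹ n} {v w} → v ∈ Span x → w ∈ Span x → v +ᴹ w ∈ Span x
  span-+ {x = x} (c , v≈) (d , w≈) =
    _ , ≈ᴹ-trans (+ᴹ-cong v≈ w≈) (≈ᴹ-sym (combination-+ c d x))

  0∈span : ∀ {n} (x : Vector Carrierᴹ n) → 0ᴹ ∈ Span x
  0∈span x = (λ _ → 0ℚ) , ≈ᴹ-sym (combination-0 x (λ _ → refl))

  member∈span : ∀ {n} (x : Vector Carrierᴹ n) i → x i ∈ Span x
  member∈span {suc n} x zero = indicator , ≈ᴹ-sym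
    (≈ᴹ-trans (+ᴹ-cong (*ₗ-identityˡ (x zero)) (combination-0 (x ∘ suc) (λ _ → refl)))
      (+ᴹ-identityʳ (x zero)))
    where
    indicator : Vector ℚ (suc n)
    indicator zero = 1ℚ
    indicator (suc _) = 0ℚ
  member∈span {suc n} x (suc i) = let (c , e) = member∈span (x ∘ suc) i in
    cons c , ≈ᴹ-sym (≈ᴹ-trans (+ᴹ-congʳ (*ₗ-zeroˡ (x zero))) (≈ᴹ-trans (+ᴹ-identityˡ _) (≈ᴹ-sym e)))
    where
    cons : Vector ℚ n → Vector ℚ (suc n)
    cons c zero = 0ℚ
    cons c (suc k) = c k

  span-image : ∀ g {n} (x : Vector Carrierᴹ n) → Span (λ i → ⟦ g ⟧ (x i)) ≐ image g (Span x)
  span-image g x =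
    (λ (c , e) → combination c x , (c , ≈ᴹ-refl) , ≈ᴹ-trans e (≈ᴹ-sym (⟦⟧-combination g c x))) ,
    (λ (v , (c , e) , w≈) → c , ≈ᴹ-trans w≈ (≈ᴹ-trans (⟦⟧-cong g e) (⟦⟧-combination g c x)))

  fixes-span : ∀ g {n} (x : Vector Carrierᴹ n) → (∀ i → ⟦ g ⟧ (x i) ≈ᴹ x i) →
               ∀ {v} → v ∈ Span x → ⟦ g ⟧ v ≈ᴹ v
  fixes-span g x fixed (c , e) = ≈ᴹ-trans (⟦⟧-cong g e) (≈ᴹ-trans (⟦⟧-combination g c x)
    (≈ᴹ-trans (combination-cong (λ _ → refl) fixed) (≈ᴹ-sym e)))

  sub-add : ∀ v w → (v -ᴹ w) +ᴹ w ≈ᴹ v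
  sub-add v w = ≈ᴹ-trans (+ᴹ-assoc v (-ᴹ w) w)
    (≈ᴹ-trans (+ᴹ-congˡ (-ᴹ‿inverseˡ w)) (+ᴹ-identityʳ v))

module Forms {p q} (V : QuadraticSpace p q) where
  open QuadraticSpace V
  open Combinations space
  open Automorphism using (⟦⟧-cong; 0ᴹ-homo)

  Perp : Pred Carrierᴹ 0ℓ → Pred Carrierᴹ 0ℓ
  Perp S v = ∀ {w} → w ∈ S → ⟪ v , w ⟫ ≡ 0ℚ

  ⟪⟫-0 : ∀ w → ⟪ 0ᴹ , w ⟫ ≡ 0ℚ
  ⟪⟫-0 w = trans (⟪⟫-cong (≈ᴹ-sym (*ₗ-zeroˡ 0ᴹ)) ≈ᴹ-refl)
    (trans (⟪⟫-* 0ℚ 0ᴹ w) (ℚ.*-zeroˡ ⟪ 0ᴹ , w ⟫))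

  ⟪⟫-neg : ∀ v w → ⟪ -ᴹ v , w ⟫ ≡ ℚ.- ⟪ v , w ⟫
  ⟪⟫-neg v w = ℚ+.inverseˡ-unique ⟪ -ᴹ v , w ⟫ ⟪ v , w ⟫
    (trans (sym (⟪⟫-+ (-ᴹ v) v w)) (trans (⟪⟫-cong (-ᴹ‿inverseˡ v) ≈ᴹ-refl) (⟪⟫-0 w)))

  ⟪⟫-sub : ∀ u v w → ⟪ u -ᴹ v , w ⟫ ≡ ⟪ u , w ⟫ ℚ.- ⟪ v , w ⟫
  ⟪⟫-sub u v w = trans (⟪⟫-+ u (-ᴹ v) w) (cong (⟪ u , w ⟫ ℚ.+_) (⟪⟫-neg v w))

  ⟪⟫-combination : ∀ {n} (c : Vector ℚ n) x w →
                   ⟪ combination c x , w ⟫ ≡ ℚΣ.sum (λ i → c i ℚ.* ⟪ x i , w ⟫)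
  ⟪⟫-combination {zero} c x w = ⟪⟫-0 w
  ⟪⟫-combination {suc n} c x w = trans (⟪⟫-+ _ _ w)
    (cong₂ ℚ._+_ (⟪⟫-* (c zero) (x zero) w) (⟪⟫-combination (c ∘ suc) (x ∘ suc) w))

  Isometry : Pred Automorphism 0ℓ
  Isometry g = ∀ v w → ⟪ ⟦ g ⟧ v , ⟦ g ⟧ w ⟫ ≡ ⟪ v , w ⟫

  perp-sub : ∀ {S u v} → u ∈ Perp S → v ∈ Perp S → u -ᴹ v ∈ Perp S
  perp-sub {u = u} {v} u⊥ v⊥ {w} w∈ =
    trans (⟪⟫-sub u v w) (cong₂ ℚ._-_ (u⊥ w∈) (v⊥ w∈))

  perp-image : ∀ {g S} → Isometry g → S ⊆ image g S → ∀ {v} → v ∈ Perp S → ⟦ g ⟧ v ∈ Perp S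
  perp-image {g} iso S⊆ {v} v⊥ w∈ = let (w′ , w′∈ , w≈) = S⊆ w∈ in
    trans (⟪⟫-cong ≈ᴹ-refl w≈) (trans (iso v w′) (v⊥ w′∈))

  radical-image : ∀ {g n} {X : Vector Carrierᴹ n} → Isometry g →
                  Radical (λ i → ⟦ g ⟧ (X i)) ≐ image g (Radical X)
  radical-image {g} {X = X} iso = to , from
    where
    to : Radical (λ i → ⟦ g ⟧ (X i)) ⊆ image g (Radical X)
    to (v∈ , v⊥) = let (v′ , v′∈ , v≈) = proj₁ (span-image g X) v∈ in
      v′ , (v′∈ , λ {w} w∈ → trans (sym (iso v′ w))
        (trans (⟪⟫-cong (≈ᴹ-sym v≈) ≈ᴹ-refl)
          (v⊥ (proj₂ (span-image g X) (w , w∈ , ≈ᴹ-refl))))) , v≈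
    from : image g (Radical X) ⊆ Radical (λ i → ⟦ g ⟧ (X i))
    from (v′ , (v′∈ , v′⊥) , v≈) =
      proj₂ (span-image g X) (v′ , v′∈ , v≈) ,
      λ w∈ → let (w′ , w′∈ , w≈) = proj₁ (span-image g X) w∈ in
        trans (⟪⟫-cong v≈ w≈) (trans (iso v′ w′) (v′⊥ w′∈))

  module _ {S : Pred Carrierᴹ 0ℓ}
           (S-resp : ∀ {v w} → v ≈ᴹ w → v ∈ S → w ∈ S) (0∈S : 0ᴹ ∈ S)
           (anisotropic : ∀ {v} → v ∈ Perp S → ⟪ v , v ⟫ ≡ 0ℚ → v ∈ S)
           {g : Automorphism} (iso : Isometry g) (S⊆gS : S ⊆ image g S) where

    private
      gperp : ∀ {v} → v ∈ Perp S → ⟦ g ⟧ v ∈ Perp S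
      gperp = perp-image {g} iso S⊆gS

      power-perp : ∀ k {x} → x ∈ Perp S → ([ g -1]^ k) x ∈ Perp S
      power-perp zero x⊥ = x⊥
      power-perp (suc k) x⊥ = let y⊥ = power-perp k x⊥ in perp-sub (gperp y⊥) y⊥

    perp-descent : ∀ {x} → x ∈ Perp S → ([ g -1]^ 2) x ∈ S → ([ g -1]^ 1) x ∈ S
    perp-descent {x} x⊥ gu-u∈S = anisotropic (perp-sub (gperp x⊥) x⊥) (begin
      ⟪ u , u ⟫                              ≡⟨ ⟪⟫-sub gx x u ⟩
      ⟪ gx , u ⟫ ℚ.- ⟪ x , u ⟫               ≡⟨ cong (ℚ._-_ ⟪ gx , u ⟫) (iso x u) ⟨
      ⟪ gx , u ⟫ ℚ.- ⟪ gx , gu ⟫             ≡⟨ cong₂ ℚ._-_ (⟪⟫-sym gx u) (⟪⟫-sym gx gu) ⟩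
      ⟪ u , gx ⟫ ℚ.- ⟪ gu , gx ⟫             ≡⟨ cong (ℚ._-_ ⟪ u , gx ⟫)
        (ℚ+.x∙y⁻¹≈ε⇒x≈y ⟪ gu , gx ⟫ ⟪ u , gx ⟫ (begin
          ⟪ gu , gx ⟫ ℚ.- ⟪ u , gx ⟫         ≡⟨ ⟪⟫-sub gu u gx ⟨
          ⟪ gu -ᴹ u , gx ⟫                   ≡⟨ ⟪⟫-sym (gu -ᴹ u) gx ⟩
          ⟪ gx , gu -ᴹ u ⟫                   ≡⟨ gperp x⊥ gu-u∈S ⟩
          0ℚ                                 ∎)) ⟩
      ⟪ u , gx ⟫ ℚ.- ⟪ u , gx ⟫              ≡⟨ ℚ.+-inverseʳ ⟪ u , gx ⟫ ⟩
      0ℚ                                     ∎)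
      where
      open ≡-Reasoning
      gx = ⟦ g ⟧ x
      u = gx -ᴹ x
      gu = ⟦ g ⟧ u

    perp-descents : ∀ k {x} → x ∈ Perp S → ([ g -1]^ suc k) x ∈ S → ⟦ g ⟧ x -ᴹ x ∈ S
    perp-descents zero x⊥ ∈S = ∈S
    perp-descents (suc k) x⊥ ∈S = perp-descents k x⊥ (perp-descent (power-perp k x⊥) ∈S)

    unipotent-trivial-on-perp : g ∈ IsUnipotent → ∀ {x} → x ∈ Perp S → ⟦ g ⟧ x -ᴹ x ∈ S
    unipotent-trivial-on-perp (k , nilpotent) {x} x⊥ =
      perp-descents k x⊥ (S-resp (≈ᴹ-sym (begin
        ⟦ g ⟧ y -ᴹ y   ≈⟨ +ᴹ-congʳ (⟦⟧-cong g (nilpotent x)) ⟩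
        ⟦ g ⟧ 0ᴹ -ᴹ y  ≈⟨ +ᴹ-cong (0ᴹ-homo g) (-ᴹ‿cong (nilpotent x)) ⟩
        0ᴹ -ᴹ 0ᴹ       ≈⟨ -ᴹ‿inverseʳ 0ᴹ ⟩
        0ᴹ             ∎)) 0∈S)
      where
      open SetoidReasoning vectorSetoid
      y = ([ g -1]^ k) x

module Lorentzian {p} (V : QuadraticSpace p 1) where
  open QuadraticSpace V
  open Combinations space
  open Forms V
  open GroupProperties +ᴹ-group using (x∙y⁻¹≈ε⇒x≈y)

  private
    b : Vector Carrierᴹ (p ℕ.+ 1)
    b = b⁺ ++ b⁻

    time : Carrierᴹ
    time = b⁻ zero

  module _ {w} (w⊥time : ⟪ w , time ⟫ ≡ 0ℚ) (w-null : ⟪ w , w ⟫ ≡ 0ℚ) where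
    private
      spanned = IsBasis.spanning diagonalizing w
      c = proj₁ spanned

      pairing : ∀ i → ⟪ w , b i ⟫ ≡ c i ℚ.* ⟪ b i , b i ⟫
      pairing i = trans (⟪⟫-cong (proj₂ spanned) ≈ᴹ-refl) (trans (⟪⟫-combination c b (b i))
        (sum-punctured (λ k → c k ℚ.* ⟪ b k , b i ⟫) i
          (λ k k≢i → trans (cong (c k ℚ.*_) (orthogonal k i k≢i)) (ℚ.*-zeroʳ (c k)))))

      term : Vector ℚ (p ℕ.+ 1)
      term i = c i ℚ.* c i ℚ.* ⟪ b i , b i ⟫

      sum-term : ℚΣ.sum term ≡ 0ℚ
      sum-term = begin
        ℚΣ.sum term                          ≡⟨ ℚΣ.sum-cong-≗ (λ i → begin
          term i                               ≡⟨ ℚ.*-assoc (c i) (c i) ⟪ b i , b i ⟫ ⟩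
          c i ℚ.* (c i ℚ.* ⟪ b i , b i ⟫)      ≡⟨ cong (c i ℚ.*_) (pairing i) ⟨
          c i ℚ.* ⟪ w , b i ⟫                  ≡⟨ cong (c i ℚ.*_) (⟪⟫-sym w (b i)) ⟩
          c i ℚ.* ⟪ b i , w ⟫                  ∎) ⟩
        ℚΣ.sum (λ i → c i ℚ.* ⟪ b i , w ⟫)   ≡⟨ ⟪⟫-combination c b w ⟨
        ⟪ combination c b , w ⟫              ≡⟨ ⟪⟫-cong (proj₂ spanned) ≈ᴹ-refl ⟨
        ⟪ w , w ⟫                            ≡⟨ w-null ⟩
        0ℚ                                   ∎
        where open ≡-Reasoning

      spacelike-or-zero : ∀ i → 0ℚ ℚ.< ⟪ b i , b i ⟫ ⊎ c i ≡ 0ℚ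
      spacelike-or-zero i with splitAt p i | pairing i
      ... | inj₁ k | _ = inj₁ (positive k)
      ... | inj₂ zero | e = inj₂ (*-nonzero-cancel (c i) (ℚ.<⇒≢ (negative zero))
        (trans (sym e) w⊥time))

      term-nonneg : ∀ i → 0ℚ ℚ.≤ term i
      term-nonneg i with spacelike-or-zero i
      ... | inj₁ 0<bb = ℚ.nonNegative⁻¹ (term i)
        {{ℚ.nonNeg*nonNeg⇒nonNeg (c i ℚ.* c i) {{square-nonneg (c i)}}
          ⟪ b i , b i ⟫ {{ℚ.nonNegative (ℚ.<⇒≤ 0<bb)}}}}
      ... | inj₂ c≡0 = ℚ.≤-reflexive (sym (begin
        c i ℚ.* c i ℚ.* ⟪ b i , b i ⟫     ≡⟨ ℚ.*-assoc (c i) (c i) ⟪ b i , b i ⟫ ⟩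
        c i ℚ.* (c i ℚ.* ⟪ b i , b i ⟫)   ≡⟨ cong (ℚ._* (c i ℚ.* ⟪ b i , b i ⟫)) c≡0 ⟩
        0ℚ ℚ.* (c i ℚ.* ⟪ b i , b i ⟫)    ≡⟨ ℚ.*-zeroˡ (c i ℚ.* ⟪ b i , b i ⟫) ⟩
        0ℚ                                ∎))
        where open ≡-Reasoning

      c≡0 : ∀ i → c i ≡ 0ℚ
      c≡0 i with spacelike-or-zero i
      ... | inj₂ c≡0 = c≡0
      ... | inj₁ 0<bb = square≡0 (c i)
        (*-nonzero-cancel (c i ℚ.* c i) (ℚ.<⇒≢ 0<bb ∘ sym)
          (sum-nonneg≡0 term term-nonneg sum-term i))

    spacelike-null⇒0 : w ≈ᴹ 0ᴹ
    spacelike-null⇒0 = ≈ᴹ-trans (proj₂ spanned) (combination-0 b c≡0)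

  null-perp-null : ∀ {e v} → ¬ (e ≈ᴹ 0ᴹ) → ⟪ e , e ⟫ ≡ 0ℚ → ⟪ v , e ⟫ ≡ 0ℚ → ⟪ v , v ⟫ ≡ 0ℚ →
                   ∃[ c ] v ≈ᴹ c *ₗ e
  null-perp-null {e} {v} e≉0 ee≡0 ve≡0 vv≡0 =
    c , x∙y⁻¹≈ε⇒x≈y v (c *ₗ e) (spacelike-null⇒0 w⊥time w-null)
    where
    open ≡-Reasoning
    instance
      et≢0 : ℚ.NonZero ⟪ e , time ⟫
      et≢0 = ℚ.≢-nonZero (λ et≡0 → e≉0 (spacelike-null⇒0 et≡0 ee≡0))
    c = ⟪ v , time ⟫ ℚ.* ℚ.1/ ⟪ e , time ⟫
    w = v -ᴹ c *ₗ e

    pairing-w : ∀ u → ⟪ w , u ⟫ ≡ ⟪ v , u ⟫ ℚ.- c ℚ.* ⟪ e , u ⟫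
    pairing-w u = trans (⟪⟫-sub v (c *ₗ e) u) (cong (ℚ._-_ ⟪ v , u ⟫) (⟪⟫-* c e u))

    w⊥time : ⟪ w , time ⟫ ≡ 0ℚ
    w⊥time = begin
      ⟪ w , time ⟫                           ≡⟨ pairing-w time ⟩
      ⟪ v , time ⟫ ℚ.- c ℚ.* ⟪ e , time ⟫    ≡⟨ cong (ℚ._-_ ⟪ v , time ⟫) (begin
        c ℚ.* ⟪ e , time ⟫
          ≡⟨ ℚ.*-assoc ⟪ v , time ⟫ (ℚ.1/ ⟪ e , time ⟫) ⟪ e , time ⟫ ⟩
        ⟪ v , time ⟫ ℚ.* (ℚ.1/ ⟪ e , time ⟫ ℚ.* ⟪ e , time ⟫)
          ≡⟨ cong (⟪ v , time ⟫ ℚ.*_) (ℚ.*-inverseˡ ⟪ e , time ⟫) ⟩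
        ⟪ v , time ⟫ ℚ.* 1ℚ                  ≡⟨ ℚ.*-identityʳ ⟪ v , time ⟫ ⟩
        ⟪ v , time ⟫                         ∎) ⟩
      ⟪ v , time ⟫ ℚ.- ⟪ v , time ⟫          ≡⟨ ℚ.+-inverseʳ ⟪ v , time ⟫ ⟩
      0ℚ                                     ∎

    pairing-w≡0 : ∀ u → ⟪ v , u ⟫ ≡ 0ℚ → ⟪ e , u ⟫ ≡ 0ℚ → ⟪ w , u ⟫ ≡ 0ℚ
    pairing-w≡0 u vu≡0 eu≡0 = begin
      ⟪ w , u ⟫                        ≡⟨ pairing-w u ⟩
      ⟪ v , u ⟫ ℚ.- c ℚ.* ⟪ e , u ⟫    ≡⟨ cong₂ (λ x y → x ℚ.- c ℚ.* y) vu≡0 eu≡0 ⟩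
      0ℚ ℚ.- c ℚ.* 0ℚ                  ≡⟨ cong (ℚ._-_ 0ℚ) (ℚ.*-zeroʳ c) ⟩
      0ℚ                               ∎

    w-null : ⟪ w , w ⟫ ≡ 0ℚ
    w-null = pairing-w≡0 w
      (trans (⟪⟫-sym v w) (pairing-w≡0 v vv≡0 (trans (⟪⟫-sym e v) ve≡0)))
      (trans (⟪⟫-sym e w) (pairing-w≡0 e ve≡0 ee≡0))

  isotropic-line-anisotropic : ∀ {ℓ} → IsIsotropicLine ℓ →
    ∀ {v} → v ∈ Perp ℓ → ⟪ v , v ⟫ ≡ 0ℚ → v ∈ ℓ
  isotropic-line-anisotropic ((x , independent , ℓ⊆ , ⊆ℓ) , null) {v} v⊥ vv≡0 =
    ⊆ℓ ((λ _ → proj₁ multiple) , ≈ᴹ-trans (proj₂ multiple) (≈ᴹ-sym (+ᴹ-identityʳ _)))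
    where
    e∈ℓ = ⊆ℓ {x zero} (member∈span x zero)
    e≉0 : ¬ (x zero ≈ᴹ 0ᴹ)
    e≉0 e≈0 = contradiction
      (independent (λ _ → 1ℚ)
        (≈ᴹ-trans (+ᴹ-identityʳ _) (≈ᴹ-trans (*ₗ-identityˡ (x zero)) e≈0)) zero)
      λ ()
    multiple = null-perp-null {x zero} e≉0 (null e∈ℓ) (v⊥ e∈ℓ) vv≡0

  radical-trivial-on-perp : ∀ {ℓ H} → IsIsotropicLine ℓ → IsUnipotentRadicalOf (Parabolic ℓ) H →
    ∀ {g v} → g ∈ H → v ∈ Perp ℓ → ⟦ g ⟧ v -ᴹ v ∈ ℓ
  radical-trivial-on-perp {ℓ} {H} line@((x , _ , ℓ⊆ , ⊆ℓ) , _) N {g} g∈H =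
    unipotent-trivial-on-perp
      (λ v≈w v∈ → ⊆ℓ (span-resp {x = x} v≈w (ℓ⊆ v∈))) (⊆ℓ (0∈span x))
      (isotropic-line-anisotropic line)
      {g} (proj₁ (proj₁ (⊆P g∈H))) (proj₂ (proj₂ (⊆P g∈H))) (unipotent g∈H)
    where open IsUnipotentRadicalOf N

module CuspActions {p} (V : QuadraticSpace p 1) where
  open QuadraticSpace V
  open Combinations space
  open Forms V
  open Lorentzian V
  open Automorphism using (⟦⟧-cong)

  module AtCusp (Γ N : Subgroup GL 0ℓ) {ℓ : Pred Carrierᴹ 0ℓ} (line : IsIsotropicLine ℓ)
                (radical : IsUnipotentRadicalOf (Parabolic ℓ) (Subgroup.member N))
                {n} (β : Matrix ℚ n) where
    open IsUnipotentRadicalOf radical using (⊆P)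

    private
      module G = Group GL
      module N = Subgroup N

    Γ∩N : Subgroup GL 0ℓ
    Γ∩N = Γ ⊓ N

    Γ∩N-group : Group 0ℓ 0ℓ
    Γ∩N-group = subgroup⇒group Γ∩N

    isometry : ∀ {g} → g ∈ N.member → Isometry g
    isometry g∈N = proj₁ (proj₁ (⊆P g∈N))

    ℓ-stable : ∀ {g} → g ∈ N.member → image g ℓ ≐ ℓ
    ℓ-stable g∈N = proj₂ (⊆P g∈N)

    Ω-stable : ∀ {g X} → g ∈ N.member → X ∈ Ω β ℓ → (λ i → ⟦ g ⟧ (X i)) ∈ Ω β ℓ
    Ω-stable {g} {X} g∈N (gram , rad⊆ , ⊆rad) =
      (λ i j → trans (cong (½ ℚ.*_) (isometry g∈N (X i) (X j))) (gram i j)) ,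
      (λ v∈ → let (v′ , v′∈ , v≈) = proj₁ radical-g v∈ in
        proj₁ (ℓ-stable g∈N) (v′ , rad⊆ v′∈ , v≈)) ,
      (λ v∈ → let (v′ , v′∈ , v≈) = proj₂ (ℓ-stable g∈N) v∈ in
        proj₂ radical-g (v′ , ⊆rad v′∈ , v≈))
      where radical-g = radical-image {g} {X = X} (isometry g∈N)

    Ω-action : Action Γ∩N-group (ΩSetoid β ℓ)
    Ω-action = record
      { act = λ (g , _ , g∈N) (X , X∈Ω) → (λ i → ⟦ g ⟧ (X i)) , Ω-stable {g} g∈N X∈Ω
      ; act-cong = λ {g} {_} {_} {Y} g≈h X≈Y i →
          ≈ᴹ-trans (⟦⟧-cong (proj₁ g) (X≈Y i)) (g≈h (proj₁ Y i))
      ; act-ε = λ _ _ → ≈ᴹ-refl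
      ; act-∙ = λ _ _ _ _ → ≈ᴹ-refl
      }

    module _ {U : Pred Carrierᴹ 0ℓ} {X₀ : Vector Carrierᴹ n}
             (X₀∈Ω : X₀ ∈ Ω β ℓ) (X₀-spans : Span X₀ ≐ U) where

      U-stable : ∀ {g u} → g ∈ N.member → u ∈ U → ⟦ g ⟧ u ∈ U
      U-stable {g} {u} g∈N u∈U = proj₁ X₀-spans (span-resp (sub-add (⟦ g ⟧ u) u)
        (span-+ (proj₁ (⊆rad (radical-trivial-on-perp line radical {g} g∈N u⊥ℓ))) u∈span))
        where
        u∈span = proj₂ X₀-spans u∈U
        ⊆rad = proj₂ (proj₂ X₀∈Ω)
        u⊥ℓ : u ∈ Perp ℓ
        u⊥ℓ {w} w∈ℓ = trans (⟪⟫-sym u w) (proj₂ (⊆rad w∈ℓ) u∈span)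

      Ω-spanning-stable : ∀ {g X} → g ∈ N.member → X ∈ Ω-spanning β ℓ U →
                          (λ i → ⟦ g ⟧ (X i)) ∈ Ω-spanning β ℓ U
      Ω-spanning-stable {g} {X} g∈N (X∈Ω , span⊆ , ⊆span) = Ω-stable {g} g∈N X∈Ω ,
        (λ v∈ → let (v′ , v′∈ , v≈) = proj₁ (span-image g X) v∈ in
          U-resp (≈ᴹ-sym v≈) (U-stable {g} g∈N (span⊆ v′∈))) ,
        (λ {u} u∈U → proj₂ (span-image g X)
          (⟦ g ⁻¹ᴳ ⟧ u , ⊆span (U-stable {g ⁻¹ᴳ} (N.⁻¹-closed {g} g∈N) u∈U) , ≈ᴹ-sym (G.inverseʳ g u)))
        where
        U-resp : ∀ {v w} → v ≈ᴹ w → v ∈ U → w ∈ U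
        U-resp v≈w v∈ = proj₁ X₀-spans (span-resp v≈w (proj₂ X₀-spans v∈))

      Γᵤ : Pred Automorphism 0ℓ
      Γᵤ = Fixing N U ∩ Subgroup.member Γ∩N

      Γᵤ-normal : IsNormalSubgroup Γ∩N-group (proj₁ ⊢ Γᵤ)
      Γᵤ-normal = record
        { isSubgroup = record
          { resp = λ {x} {y} x≈y ((_ , fixed) , _) →
              (proj₂ (proj₂ y) , λ u∈ → ≈ᴹ-trans (≈ᴹ-sym (x≈y _)) (fixed u∈)) , proj₂ y
          ; ∙-closed = λ {x} {y} ((_ , x-fixed) , _) ((_ , y-fixed) , _) →
              within (x J.∙ y) λ u∈ → ≈ᴹ-trans (⟦⟧-cong (proj₁ x) (y-fixed u∈)) (x-fixed u∈)
          ; ε-closed = within J.ε λ _ → ≈ᴹ-refl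
          ; ⁻¹-closed = λ {x} ((_ , fixed) , _) →
              within (x J.⁻¹) λ {u} u∈ → ≈ᴹ-trans
                (⟦⟧-cong (proj₁ x ⁻¹ᴳ) (≈ᴹ-sym (fixed u∈))) (G.inverseˡ (proj₁ x) u)
          }
        ; conj-closed = λ g {h} ((_ , fixed) , _) →
            within (g J.∙ h J.∙ g J.⁻¹) λ {u} u∈ → ≈ᴹ-trans
              (⟦⟧-cong (proj₁ g)
                (fixed (U-stable {proj₁ g ⁻¹ᴳ} (N.⁻¹-closed {proj₁ g} (proj₂ (proj₂ g))) u∈)))
              (G.inverseʳ (proj₁ g) u)
        }
        where
        module J = Group Γ∩N-group
        within : ∀ x → (∀ {u} → u ∈ U → ⟦ proj₁ x ⟧ u ≈ᴹ u) → proj₁ x ∈ Γᵤ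
        within (g , g∈Γ , g∈N) fixed = (g∈N , fixed) , g∈Γ , g∈N

      Ω-spanning-action : Action (quotient Γ∩N-group Γᵤ-normal) (Ω-spanningSetoid β ℓ U)
      Ω-spanning-action = record
        { act = λ (g , _ , g∈N) (X , X∈) → (λ i → ⟦ g ⟧ (X i)) , Ω-spanning-stable {g} g∈N X∈
        ; act-cong = λ {(g , _)} {(h , _ , h∈N)} {_} {(Y , Y∈)} ((_ , fixed) , _) X≈Y i →
            ≈ᴹ-trans (⟦⟧-cong g (≈ᴹ-trans (X≈Y i) (≈ᴹ-sym (G.inverseˡ h (Y i)))))
              (fixed (proj₁ (proj₂ (Ω-spanning-stable {h} h∈N Y∈)) (member∈span (λ k → ⟦ h ⟧ (Y k)) i)))
        ; act-ε = λ _ _ → ≈ᴹ-refl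
        ; act-∙ = λ _ _ _ _ → ≈ᴹ-refl
        }

      Ω-spanning-action-free : Action.IsFree Ω-spanning-action
      Ω-spanning-action-free (g , g∈Γ , g∈N) (X , _ , _ , ⊆span) gX≈X =
        (N.resp {g} {gε⁻¹} (λ v → ≈ᴹ-refl) g∈N , λ u∈ → fixes-span g X gX≈X (⊆span u∈)) ,
        Subgroup.resp Γ∩N {g} {gε⁻¹} (λ v → ≈ᴹ-refl) (g∈Γ , g∈N)
        where gε⁻¹ = g ∙ᴳ (G.ε ⁻¹ᴳ)

lemma3p3 :
  ∀ {p : ℕ} (V : QuadraticSpace p 1) →
  let open QuadraticSpace V in
  ∀ (L : Pred Carrierᴹ 0ℓ) → IsFullLattice L → L ⊆ (L #) →
  ∀ {n : ℕ} → 1 ≤ n → n ≤ p →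
  ∀ (h : Vector Carrierᴹ n) → (∀ i → h i ∈ (L #)) →
  ∀ (Γ : Subgroup GL 0ℓ) →
  let Γ∈ = Subgroup.member Γ in
  HasFiniteIndexIn GL Γ∈ (Stabilizer L) → IsNeat Γ∈ → ActsTriviallyOnDiscriminant L Γ∈ →
  (∃[ v ] ¬ (v ≈ᴹ 0ᴹ) × ⟪ v , v ⟫ ≡ 0ℚ) →
  ∀ {r : ℕ} (ℓ : Vector (Pred Carrierᴹ 0ℓ) (suc r)) → RepresentsCusps Γ∈ ℓ →
  ∀ (N : Vector (Subgroup GL 0ℓ) (suc r)) →
  (∀ j → IsUnipotentRadicalOf (Parabolic (ℓ j)) (Subgroup.member (N j))) →
  ∀ (β : Matrix ℚ n) → IsSymmetric β → IsPositiveSemidefinite β → HasRank β (n ∸ 1) →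
  ∀ (j : Fin (suc r)) (U : Pred Carrierᴹ 0ℓ) → HasDimension U n →
  (∃[ X ] X ∈ Ω β (ℓ j) × (∀ i → (X i -ᴹ h i) ∈ L) × Span X ≐ U) →
  let Γⱼ = Γ ⊓ N j
      Γᵤ = Fixing (N j) U ∩ Subgroup.member Γⱼ
      Γⱼ-group = subgroup⇒group Γⱼ
      _≈Ω_ = Setoid._≈_ (ΩSetoid β (ℓ j))
  in
  Σ (Action Γⱼ-group (ΩSetoid β (ℓ j))) λ ρ →
    (∀ γ X i → proj₁ (Action.act ρ γ X) i ≈ᴹ ⟦ proj₁ γ ⟧ (proj₁ X i)) ×
    Σ (IsNormalSubgroup Γⱼ-group (proj₁ ⊢ Γᵤ)) λ normal →
      Σ (Action (quotient Γⱼ-group normal) (Ω-spanningSetoid β (ℓ j) U)) λ ρ̄ →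
        (∀ γ X → forgetSpan β (ℓ j) (Action.act ρ̄ γ X) ≈Ω Action.act ρ γ (forgetSpan β (ℓ j) X)) ×
        Action.IsFree ρ̄
lemma3p3 V L _ _ _ _ _ _ Γ _ _ _ _ ℓ cusps N radicals β _ _ _ j U _ (X₀ , X₀∈Ω , _ , X₀-spans) =
  Ω-action , (λ _ _ _ → ≈ᴹ-refl) ,
  Γᵤ-normal X₀∈Ω X₀-spans ,
  Ω-spanning-action X₀∈Ω X₀-spans ,
  (λ _ _ _ → ≈ᴹ-refl) ,
  Ω-spanning-action-free X₀∈Ω X₀-spans
  where
  open QuadraticSpace V
  open CuspActions.AtCusp V Γ (N j) (RepresentsCusps.isotropic cusps j) (radicals j) β
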